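{- There are positive absolute constants $c$ and $c'$ such that $Q(n,\epsilon,5)>c\,\epsilon^{ -2}$ whenever $\epsilon>c'(\log n)^{ -1/3}$.
   Context: The diameter of a connected graph is the maximum distance between two vertices ($\infty$ if disconnected); the diameter of an edge set $E'$ is the diameter of the graph with edge set $E'$ on the vertices covered by $E'$. $Q(n,\epsilon,d)$ is the minimum $\ell$ such that the edges of any graph on $n$ vertices with minimum degree at least $\epsilon n$ can be covered by $\ell$ edge sets each of diameter at most $d$. Logarithms are base 2.
   Formalization: It is additionally assumed that εn ≤ n−1, i.e. some graph on n vertices has minimum degree at least εn (otherwise Q = 0 and the claim fails, e.g. ε = 2); ε, c and c' are rational, from which the case of real ε follows since Q depends only on the ceiling of εn. -}

module Defs where

open import Data.Nat as ℕ using (ℕ; zero; suc; _^_)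
open import Data.Integer as ℤ using (ℤ; +_; ∣_∣)
open import Data.Rational as ℚ using (ℚ; 0ℚ; ↥_; ↧ₙ_)
open import Data.Fin using (Fin)
open import Data.Bool using (Bool; true; false)
open import Data.List using (List; filter; length)
open import Data.List using () renaming (allFin to allFinL)
open import Data.Product using (Σ; ∃; ∃-syntax; _×_; _,_)
open import Data.Sum using (_⊎_)
open import Relation.Binary.PropositionalEquality using (_≡_)
open import Relation.Nullary using (¬_)
open import Data.Bool using (T?)

ℕ→ℚ : ℕ → ℚ
ℕ→ℚ n = (+ n) ℚ./ 1

record Graph (n : ℕ) : Set where
  field
    adj   : Fin n → Fin n → Bool
    sym   : ∀ u v → adj u v ≡ adj v u
    irr   : ∀ u → adj u u ≡ false
open Graph public

deg : ∀ {n} → Graph n → Fin n → ℕ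
deg {n} G u = length (filter (λ v → T? (adj G u v)) (allFinL n))

MinDegAtLeast : ∀ {n} → Graph n → ℚ → Set
MinDegAtLeast {n} G ε = ∀ u → ε ℚ.* ℕ→ℚ n ℚ.≤ ℕ→ℚ (deg G u)

record EdgeSet (n : ℕ) : Set where
  field
    mem  : Fin n → Fin n → Bool
    msym : ∀ u v → mem u v ≡ mem v u
open EdgeSet public

data Walk {n : ℕ} (E : EdgeSet n) : Fin n → Fin n → ℕ → Set where
  nil  : ∀ {u} → Walk E u u zero
  cons : ∀ {u w v k} → mem E u w ≡ true → Walk E w v k → Walk E u v (suc k)

Covered : ∀ {n} → EdgeSet n → Fin n → Set
Covered E u = ∃[ w ] (mem E u w ≡ true)

DiamAtMost : ∀ {n} → EdgeSet n → ℕ → Set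
DiamAtMost E d = ∀ u v → Covered E u → Covered E v → ∃[ k ] (k ℕ.≤ d × Walk E u v k)

CoverableBy : ∀ {n} → Graph n → ℕ → ℕ → Set
CoverableBy {n} G d ℓ =
  Σ (Fin ℓ → EdgeSet n) λ F →
    (∀ i u v → mem (F i) u v ≡ true → adj G u v ≡ true) ×
    (∀ i → DiamAtMost (F i) d) ×
    (∀ u v → adj G u v ≡ true → ∃[ i ] (mem (F i) u v ≡ true))

QWorks : ℕ → ℚ → ℕ → ℕ → Set
QWorks n ε d ℓ = ∀ (G : Graph n) → MinDegAtLeast G ε → CoverableBy G d ℓ

IsQ : ℕ → ℚ → ℕ → ℕ → Set
IsQ n ε d q = QWorks n ε d q × (∀ ℓ → ℓ ℕ.< q → ¬ QWorks n ε d ℓ)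

-- x < log₂ n  (exact, for rational x and natural n; false if n = 0).
-- For x = a/b ≥ 0 (b > 0): log₂ n > a/b  ⇔  n^b > 2^a.
-- For x < 0: log₂ n > x ⇔ n ≥ 1.
_<log₂_ : ℚ → ℕ → Set
x <log₂ n = (x ℚ.< 0ℚ × 1 ℕ.≤ n) ⊎ (0ℚ ℚ.≤ x × 2 ^ ∣ ↥ x ∣ ℕ.< n ^ (↧ₙ x))

cube : ℚ → ℚ
cube x = x ℚ.* x ℚ.* x

{-# OPTIONS --safe #-}
module Submission where

-- Put t ≈ 1/(48 ε).  In a shift graph, the pair (i , j) is adjacent to every pair (j , k); its
-- chromatic number is logarithmic in the number of indices, although its vertices can be
-- represented by sets of density at least 1/4 such that adjacent pairs get disjoint sets.
-- Take 2t clusters, t on each of two sides, each with a dense core, and one port vertex per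
-- cluster and pair, joined to the set of the pair inside the core.  Two ports of a cluster with
-- adjacent pairs are at distance 4.  For each pair, join the ports in all clusters of one side to
-- those of the other.  Edges with adjacent pairs and different ends have endpoints at distance 6,
-- so they lie in no common set of diameter 5.  With fewer than t² sets, each pair has two of its
-- t² edges in one set, which gives a proper colouring of the shift graph with fewer than t²
-- colours, and there are too many indices (2 to the t²) for that.

open import Defs
open import Data.Nat using (ℕ; _≤_; _<_)
open import Data.Rational using (ℚ; 0ℚ; _*_; _÷_; >-nonZero) renaming (_<_ to _<ℚ_; _≤_ to _≤ℚ_; _-_ to _-ℚ_)
open import Data.Product using (Σ; ∃; ∃-syntax; _×_; _,_)

open import Algebra.Bundles using (CommutativeMonoid)
open import Data.Bool using (Bool; true; false; not; _∧_; _xor_; if_then_else_; T?)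
  renaming (_≟_ to _≟ᵇ_)
open import Data.Bool.Properties using (∨-comm; ∧-zeroʳ; ∧-identityʳ; T-≡; not-injective)
open import Data.Fin using (Fin; remQuot; combine; _↑ʳ_; punchIn; splitAt; finToFun; funToFin)
open import Data.Fin.Patterns using (0F; 1F; 2F)
import Data.Fin.Properties as Finₚ
open import Data.List using (filter; length) renaming (allFin to allFinL)
open import Data.List.Membership.Propositional using (_∈_)
open import Data.List.Membership.Setoid.Properties using (index-injective)
open import Data.List.Membership.Propositional.Properties using (∈-filter⁺; ∈-allFin)
open import Data.List.Relation.Unary.Any using (index)
open import Data.Integer as ℤ using (+_)
import Data.Integer.Properties as ℤₚ
import Data.Nat as ℕ
import Data.Nat.DivMod as DivMod
import Data.Nat.Properties as ℕₚ
open import Data.Nat.Tactic.RingSolver using (solve-∀)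
open import Data.Product using (proj₁; proj₂; ∃₂; swap; uncurry)
import Data.Product.Properties as ×ₚ
open import Data.Product.Function.NonDependent.Propositional using (_×-↔_)
open import Data.Rational as ℚ using (mkℚ)
import Data.Rational.Properties as ℚₚ
open import Data.Rational.Unnormalised as ℚᵘ using (mkℚᵘ)
import Data.Rational.Unnormalised.Properties as ℚᵘₚ
open import Data.Sum using (_⊎_; inj₁; inj₂; [_,_]′)
open import Data.Vec using (Vec; []; _∷_)
import Data.Vec.Properties as Vecₚ
open import Function using (_∘_; _↔_; Inverse; Injection; Equivalence; Injective; mk↔ₛ′)
open import Function.Properties.Inverse using (↔-sym; ↔-trans; ↔-refl; ↔⇒↣)
open import Level using (Level)
open import Relation.Binary using (DecidableEquality)
open import Relation.Binary.PropositionalEquality renaming (sym to ≡-sym)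
open import Relation.Nullary using (¬_; Dec; yes; no; does; contradiction; ¬?; _×-dec_; _⊎-dec_)
open import Relation.Nullary.Decidable using (dec-true; dec-false)
open import Relation.Unary using (Pred; Decidable)

private variable
  a p : Level
  A : Set a
  k ℓ m n r : ℕ

-- Counting with tags, and walks

does⇒ : (d : Dec A) → does d ≡ true → A
does⇒ (yes x) _ = x

-- The position of `proj₁ (f x)` in the filtered list, combined with the tag, determines `f x` and
-- hence `x`. The tag lets up to `r` elements share one vertex, so a degree can be bounded by a map
-- that is only `r`-to-one.
length-filter-≥ : {P : Pred (Fin n) p} (P? : Decidable P) →
                  Fin m ↔ A → (f : A → Fin n × Fin r) → Injective _≡_ _≡_ f →
                  (∀ x → P (proj₁ (f x))) → m ≤ length (filter P? (allFinL n)) ℕ.* r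
length-filter-≥ {n = n} {P = P} P? e f f-inj Pf =
  Finₚ.injective⇒≤ {f = λ x → code (Inverse.to e x)} λ eq →
    Injection.injective (↔⇒↣ e) (f-inj (code-inj _ _ eq))
  where
  member : ∀ x → proj₁ (f x) ∈ filter P? (allFinL n)
  member x = ∈-filter⁺ P? (∈-allFin _) (Pf x)
  code : _ → _
  code x = combine (index (member x)) (proj₂ (f x))
  code-inj : ∀ x y → code x ≡ code y → f x ≡ f y
  code-inj x y eq =
    let index-eq , tag-eq = Finₚ.combine-injective (index (member x)) _ (index (member y)) _ eq
    in cong₂ _,_ (index-injective (setoid _) (member x) (member y) index-eq) tag-eq

-- Each step raises `f` by at most one. Distances are bounded from below in this way, without an
-- analysis of walks.
walk-bound : {E : EdgeSet n} (f : Fin n → ℕ) →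
             (∀ u v → mem E u v ≡ true → f v ≤ 1 ℕ.+ f u) →
             ∀ {u v} → Walk E u v k → f v ≤ k ℕ.+ f u
walk-bound f lip nil = ℕₚ.≤-refl
walk-bound {k = ℕ.suc k} f lip (cons {u} {w} {v} e walk) = begin
  f v                    ≤⟨ walk-bound f lip walk ⟩
  k ℕ.+ f w              ≤⟨ ℕₚ.+-monoʳ-≤ k (lip u w e) ⟩
  k ℕ.+ (1 ℕ.+ f u)      ≡⟨ ℕₚ.+-suc k (f u) ⟩
  ℕ.suc k ℕ.+ f u        ∎
  where open ℕₚ.≤-Reasoning

-- Colourings of the shift graph

-- The colours i ↦ { χ i k : k } are distinct sets: χ i j belongs to that of i and not to that of j.
shift-colouring : (χ : Fin n → Fin n → Fin ℓ) →
                  (∀ i j k → i ≢ j → χ i j ≢ χ j k) → n ≤ 2 ℕ.^ ℓ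
shift-colouring {n} {ℓ} χ proper = Finₚ.injective⇒≤ {f = colours} colours-inj
  where
  used? : ∀ i γ → Dec (∃ λ k → χ i k ≡ γ)
  used? i γ = Finₚ.any? λ k → χ i k Finₚ.≟ γ
  indicator : Fin n → Fin ℓ → Fin 2
  indicator i γ = if does (used? i γ) then 1F else 0F
  colours : Fin n → Fin (2 ℕ.^ ℓ)
  colours i = funToFin (indicator i)
  indicator-true : ∀ i γ → indicator i γ ≡ 1F → ∃ λ k → χ i k ≡ γ
  indicator-true i γ eq with used? i γ
  ... | yes u = u
  indicator-χ : ∀ i j → indicator i (χ i j) ≡ 1F
  indicator-χ i j rewrite dec-true (used? i (χ i j)) (j , refl) = refl
  colours-inj : Injective _≡_ _≡_ colours
  colours-inj {i} {j} eq with i Finₚ.≟ j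
  ... | yes i≡j = i≡j
  ... | no i≢j =
    let γ = χ i j
        same = trans (≡-sym (Finₚ.finToFun-funToFin (indicator i) γ))
                 (trans (cong (λ c → finToFun c γ) eq) (Finₚ.finToFun-funToFin (indicator j) γ))
        k , χjk≡γ = indicator-true j γ (trans (≡-sym same) (indicator-χ i j))
    in contradiction (≡-sym χjk≡γ) (proper i j k i≢j)

-- Inner products over the field of two elements

infixl 7 _∙_
_∙_ : Vec Bool n → Vec Bool n → Bool
[]       ∙ []       = false
(x ∷ xs) ∙ (y ∷ ys) = (x ∧ y) xor (xs ∙ ys)

xor-cancelˡ : ∀ x {y z} → x xor y ≡ x xor z → y ≡ z
xor-cancelˡ false eq = eq
xor-cancelˡ true  eq = not-injective eq

xor-cancelʳ : ∀ x {y z} → y xor x ≡ z xor x → y ≡ z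
xor-cancelʳ _     {false} {false} _ = refl
xor-cancelʳ _     {true}  {true}  _ = refl
xor-cancelʳ false {true}  {false} ()
xor-cancelʳ true  {true}  {false} ()
xor-cancelʳ false {false} {true}  ()
xor-cancelʳ true  {false} {true}  ()

_≟ᵛ_ : DecidableEquality (Vec Bool n)
_≟ᵛ_ = Vecₚ.≡-dec _≟ᵇ_

-- At least half of all vectors y satisfy i ∙ y ≢ j ∙ y (the distance of the Hadamard code):
-- changing one coordinate of y at which i and j differ corrects every bad y, and the
-- Boolean remembers the overwritten coordinate.
hadamard : (i j : Vec Bool n) → i ≢ j →
           ∃ λ (g : Vec Bool n → Vec Bool n × Bool) → Injective _≡_ _≡_ g ×
             (∀ y → i ∙ proj₁ (g y) ≢ j ∙ proj₁ (g y))
hadamard [] [] i≢j = contradiction refl i≢j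
hadamard (a ∷ i) (b ∷ j) i≢j with a ≟ᵇ b
... | yes refl = g , g-inj , λ { (y ∷ ys) eq → g′-good ys (xor-cancelˡ (a ∧ y) eq) }
  where
  rec = hadamard i j (i≢j ∘ cong (a ∷_))
  g′ = proj₁ rec
  g′-good = proj₂ (proj₂ rec)
  g : _ → _
  g (y ∷ ys) = y ∷ proj₁ (g′ ys) , proj₂ (g′ ys)
  g-inj : Injective _≡_ _≡_ g
  g-inj {y ∷ ys} {z ∷ zs} eq =
    let heads , tails = Vecₚ.∷-injective (cong proj₁ eq)
    in cong₂ _∷_ heads (proj₁ (proj₂ rec) (cong₂ _,_ tails (cong proj₂ eq)))
... | no a≢b = g , g-inj , g-good
  where
  g : _ → _
  g (y ∷ ys) = does (i ∙ ys ≟ᵇ j ∙ ys) ∷ ys , y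
  g-inj : Injective _≡_ _≡_ g
  g-inj {y ∷ ys} {z ∷ zs} eq = cong₂ _∷_ (cong proj₂ eq) (Vecₚ.∷-injectiveʳ (cong proj₁ eq))
  false-case : ∀ {x y} → (a ∧ false) xor x ≡ (b ∧ false) xor y → x ≡ y
  false-case eq rewrite ∧-zeroʳ a | ∧-zeroʳ b = eq
  true-case : ∀ {x} → (a ∧ true) xor x ≡ (b ∧ true) xor x → a ≡ b
  true-case {x} eq rewrite ∧-identityʳ a | ∧-identityʳ b = xor-cancelʳ x eq
  head-good : ∀ {x y} (d : Dec (x ≡ y)) → (a ∧ does d) xor x ≢ (b ∧ does d) xor y
  head-good (no neq)   = neq ∘ false-case
  head-good (yes refl) = a≢b ∘ true-case
  g-good : ∀ y → (a ∷ i) ∙ proj₁ (g y) ≢ (b ∷ j) ∙ proj₁ (g y)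
  g-good (y ∷ ys) = head-good (i ∙ ys ≟ᵇ j ∙ ys)

Vec-Bool↔ : ∀ q → Fin (2 ℕ.^ q) ↔ Vec Bool q
Vec-Bool↔ ℕ.zero    = mk↔ₛ′ (λ _ → []) (λ _ → 0F) (λ { [] → refl }) (λ { 0F → refl ; (Fin.suc ()) })
Vec-Bool↔ (ℕ.suc q) = ↔-trans Finₚ.*↔× (↔-trans (Finₚ.2↔Bool ×-↔ Vec-Bool↔ q)
  (mk↔ₛ′ (uncurry _∷_) (λ { (x ∷ xs) → x , xs }) (λ { (x ∷ xs) → refl }) (λ _ → refl)))

-- Blow-ups with prescribed numbers of vertices

-- `copy-inj` recovers only the copy number, because `label-copy` already recovers the label.
record Blowup (n m D : ℕ) : Set where
  field
    label       : Fin n → Fin m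
    copy        : Fin m → Fin D → Fin n
    label-copy  : ∀ l d → label (copy l d) ≡ l
    copy-inj    : ∀ {l l′ d d′} → copy l d ≡ copy l′ d′ → d ≡ d′

-- The first `r` vertices, the remainder of a division by `m`, all take the label `0F`, which exists
-- because `m` is nonzero.
blowup : ∀ r D m .{{_ : ℕ.NonZero m}} → Blowup (r ℕ.+ D ℕ.* m) m D
blowup r D m@(ℕ.suc _) = record
  { label = labelOf ∘ splitAt r
  ; copy = copy′
  ; label-copy = λ l d → trans (cong labelOf (Finₚ.splitAt-↑ʳ r (D ℕ.* m) (combine d l)))
                               (cong proj₂ (Finₚ.remQuot-combine d l))
  ; copy-inj = λ eq → proj₁ (Finₚ.combine-injective _ _ _ _ (Finₚ.↑ʳ-injective r _ _ eq)) }
  where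
  labelOf : Fin r ⊎ Fin (D ℕ.* m) → Fin m
  labelOf = [ (λ _ → 0F) , proj₂ ∘ remQuot {D} m ]′
  copy′ : Fin m → Fin D → Fin (r ℕ.+ D ℕ.* m)
  copy′ l d = r ↑ʳ combine d l

-- The graph on labels and its degrees

module Labels (t q : ℕ) where

  -- A cluster is a side with a number.  The kinds 0F, 1F, 2F are ports, core vertices and hubs, and
  -- hubs serve only to give core vertices a large degree.  A port has index (_ , i , j) and a core
  -- vertex (s , y , _): the unused components are padding, so that every kind is equally frequent.
  Cluster Index Label : Set
  Cluster = Bool × Fin t
  Index   = Bool × Vec Bool q × Vec Bool q
  Label   = Cluster × Fin 3 × Index

  clusters indices : ℕ
  clusters = 2 ℕ.* t
  indices  = 2 ℕ.* (2 ℕ.^ q ℕ.* 2 ℕ.^ q)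

  Index↔ : Fin indices ↔ Index
  Index↔ = ↔-trans Finₚ.*↔× (Finₚ.2↔Bool ×-↔
             ↔-trans Finₚ.*↔× (Vec-Bool↔ q ×-↔ Vec-Bool↔ q))

  Label↔ : Fin (clusters ℕ.* (3 ℕ.* indices)) ↔ Label
  Label↔ = ↔-trans Finₚ.*↔× (↔-trans Finₚ.*↔× (Finₚ.2↔Bool ×-↔ ↔-refl) ×-↔
             ↔-trans Finₚ.*↔× (↔-refl ×-↔ Index↔))

  _≟ᶜ_ : DecidableEquality Cluster
  _≟ᶜ_ = ×ₚ.≡-dec _≟ᵇ_ Finₚ._≟_

  _≟ⁱ_ : DecidableEquality Index
  _≟ⁱ_ = ×ₚ.≡-dec _≟ᵇ_ (×ₚ.≡-dec _≟ᵛ_ _≟ᵛ_)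

  -- The sets T (i , j) = { (s , y) : i ∙ y = s ≠ j ∙ y } have density 1/4 if i ≠ j, and
  -- T (i , j) is disjoint from T (j , k): these pairs form a shift graph.
  Hits : Index → Index → Set
  Hits (_ , i , j) (s , y , _) = i ∙ y ≡ s × (i ≡ j ⊎ j ∙ y ≢ s)

  hits? : ∀ x y → Dec (Hits x y)
  hits? (_ , i , j) (s , y , _) = (i ∙ y ≟ᵇ s) ×-dec ((i ≟ᵛ j) ⊎-dec ¬? (j ∙ y ≟ᵇ s))

  data Arc : Label → Label → Set where
    port  : ∀ {κ x y} → Hits x y → Arc (κ , 0F , x) (κ , 1F , y)
    hub   : ∀ {κ y z} → Arc (κ , 1F , y) (κ , 2F , z)
    cross : ∀ {c d x} → Arc ((false , c) , 0F , x) ((true , d) , 0F , x)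

  arc? : ∀ u v → Dec (Arc u v)
  arc? (κ , 0F , x) (κ′ , 1F , y) with κ ≟ᶜ κ′ | hits? x y
  ... | yes refl | yes h = yes (port h)
  ... | yes refl | no ¬h = no λ { (port h) → ¬h h }
  ... | no κ≢κ′  | _     = no λ { (port _) → κ≢κ′ refl }
  arc? (κ , 1F , y) (κ′ , 2F , z) with κ ≟ᶜ κ′
  ... | yes refl = yes hub
  ... | no κ≢κ′  = no λ { hub → κ≢κ′ refl }
  arc? ((false , c) , 0F , x) ((true , d) , 0F , x′) with x ≟ⁱ x′
  ... | yes refl = yes cross
  ... | no x≢x′  = no λ { cross → x≢x′ refl }
  arc? ((false , c) , 0F , x) ((false , d) , 0F , x′) = no λ ()
  arc? ((true , c) , 0F , x) (_ , 0F , x′) = no λ ()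
  arc? (_ , 0F , _) (_ , 2F , _) = no λ ()
  arc? (_ , 1F , _) (_ , 0F , _) = no λ ()
  arc? (_ , 1F , _) (_ , 1F , _) = no λ ()
  arc? (_ , 2F , _) (_ , _ , _) = no λ ()

  arc-irrefl : ∀ {u} → ¬ Arc u u
  arc-irrefl ()

  Adjacent : Label → Label → Set
  Adjacent u v = Arc u v ⊎ Arc v u

  adjacent? : ∀ u v → Dec (Adjacent u v)
  adjacent? u v = arc? u v ⊎-dec arc? v u

  -- For a port, `y` ranges over the vectors corrected by `hadamard`, and the first component is
  -- forced to be `i ∙ y`. The old first component and the Hadamard bit become the two tags, hence
  -- the density 1/4. For core vertices and hubs, all vertices of the other of these two kinds in
  -- the cluster suffice.
  neighbours : ∀ u → ∃ λ (g : Index → Label × Bool × Bool) → Injective _≡_ _≡_ g ×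
                 (∀ w → Adjacent u (proj₁ (g w)))
  neighbours (κ , 0F , (_ , i , j)) =
    (λ { (s , y , z) → (κ , 1F , i ∙ proj₁ (g y) , proj₁ (g y) , z) , s , proj₂ (g y) }) ,
    (λ { {s , y , z} {s′ , y′ , z′} eq →
      let leq , teq = ×ₚ.,-injective eq
          seq , beq = ×ₚ.,-injective teq
          _ , keq   = ×ₚ.,-injective leq
          _ , ieq   = ×ₚ.,-injective keq
          _ , yzeq  = ×ₚ.,-injective ieq
          yeq , zeq = ×ₚ.,-injective yzeq
      in cong₂ _,_ seq (cong₂ _,_ (proj₁ (proj₂ separated) (cong₂ _,_ yeq beq)) zeq) }) ,
    λ { (s , y , z) → inj₁ (port (refl , proj₂ (proj₂ separated) y)) }
    where
    separated : ∃ λ (g : Vec Bool q → Vec Bool q × Bool) → Injective _≡_ _≡_ g ×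
                  (∀ y → i ≡ j ⊎ j ∙ proj₁ (g y) ≢ i ∙ proj₁ (g y))
    separated with i ≟ᵛ j
    -- If `i ≡ j`, then `Hits` asks nothing of `j ∙ y`, so no vector has to be corrected.
    ... | yes i≡j = (λ y → y , false) , cong proj₁ , λ _ → inj₁ i≡j
    ... | no i≢j  = let g , g-inj , g-good = hadamard i j i≢j
                    in g , g-inj , λ y → inj₂ (g-good y ∘ ≡-sym)
    g = proj₁ separated
  neighbours (κ , 1F , _) =
    (λ w → (κ , 2F , w) , false , false) , (λ { refl → refl }) , λ _ → inj₁ hub
  neighbours (κ , 2F , _) =
    (λ w → (κ , 1F , w) , false , false) , (λ { refl → refl }) , λ _ → inj₂ hub

  -- Lower bounds for distances

  Close : ℕ → ℕ → Set
  Close m n = m ≤ 1 ℕ.+ n × n ≤ 1 ℕ.+ m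

  close-+ˡ : ∀ k {m n} → Close m n → Close (k ℕ.+ m) (k ℕ.+ n)
  close-+ˡ k {m} {n} (m≤ , n≤) =
    ℕₚ.≤-trans (ℕₚ.+-monoʳ-≤ k m≤) (ℕₚ.≤-reflexive (ℕₚ.+-suc k n)) ,
    ℕₚ.≤-trans (ℕₚ.+-monoʳ-≤ k n≤) (ℕₚ.≤-reflexive (ℕₚ.+-suc k m))

  close-+ʳ : ∀ k {m n} → Close m n → Close (m ℕ.+ k) (n ℕ.+ k)
  close-+ʳ k (m≤ , n≤) = ℕₚ.+-monoˡ-≤ k m≤ , ℕₚ.+-monoˡ-≤ k n≤

  -- The distance in the complete bipartite graph between the two sides, whose edges are the images
  -- of the cross edges.
  clusterDist : Cluster → Cluster → ℕ
  clusterDist κ@(b , _) κ′@(b′ , _) =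
    if does (κ ≟ᶜ κ′) then 0 else if does (b ≟ᵇ b′) then 2 else 1

  clusterDist-refl : ∀ κ → clusterDist κ κ ≡ 0
  clusterDist-refl κ rewrite dec-true (κ ≟ᶜ κ) refl = refl

  clusterDist-same-side : ∀ {b c d} → c ≢ d → clusterDist (b , c) (b , d) ≡ 2
  clusterDist-same-side {b} {c} {d} c≢d
    rewrite dec-false ((b , c) ≟ᶜ (b , d)) (c≢d ∘ cong proj₂) | dec-true (b ≟ᵇ b) refl = refl

  clusterDist-lipschitz : ∀ κ {c d} → Close (clusterDist κ (false , c)) (clusterDist κ (true , d))
  clusterDist-lipschitz (b , a) {c} {d} = cases b
    where
    close₁ : ∀ e → Close (if e then 0 else 2) 1
    close₁ false = ℕₚ.≤-refl , ℕₚ.m≤m+n 1 2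
    close₁ true  = ℕ.z≤n , ℕₚ.≤-refl
    cases : ∀ b → Close (clusterDist (b , a) (false , c)) (clusterDist (b , a) (true , d))
    cases false = close₁ (does (a Finₚ.≟ c))
    cases true  = swap (close₁ (does (a Finₚ.≟ d)))

  -- kindDist (_ , i , j) is a 1-Lipschitz lower bound for the distance from the port (i , j) within its
  -- cluster: other ports (i′ , j′) get 4 if i′ ≡ j, and only 2 otherwise.
  xDist : ∀ {A B : Set} → Dec A → Dec B → ℕ
  xDist (yes _) _       = 0
  xDist (no _)  (yes _) = 4
  xDist (no _)  (no _)  = 2

  yDist : ∀ {A : Set} → Dec A → ℕ
  yDist (yes _) = 1
  yDist (no _)  = 3

  kindDist : Index → Fin 3 × Index → ℕ
  kindDist x@(_ , _ , j) (0F , x′@(_ , i′ , _)) = xDist (x ≟ⁱ x′) (j ≟ᵛ i′)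
  kindDist x (1F , y) = yDist (hits? x y)
  kindDist x (2F , _) = 2

  module _ {s : Bool} {i j : Vec Bool q} (i≢j : i ≢ j) where

    kindDist-refl : kindDist (s , i , j) (0F , s , i , j) ≡ 0
    kindDist-refl = xDist-yes ((s , i , j) ≟ⁱ (s , i , j)) (j ≟ᵛ i)
      where
      xDist-yes : ∀ {A : Set} {x : A} (d : Dec (x ≡ x)) {B : Set} (e : Dec B) → xDist d e ≡ 0
      xDist-yes (yes _)  _ = refl
      xDist-yes (no x≢x) _ = contradiction refl x≢x

    kindDist-shift : ∀ {s′ k} → kindDist (s , i , j) (0F , s′ , j , k) ≡ 4
    kindDist-shift {s′} {k} = xDist-shift ((s , i , j) ≟ⁱ (s′ , j , k)) (j ≟ᵛ j)
      where
      xDist-shift : (d : Dec ((s , i , j) ≡ (s′ , j , k))) (e : Dec (j ≡ j)) → xDist d e ≡ 4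
      xDist-shift (yes refl) _      = contradiction refl i≢j
      xDist-shift (no _) (yes _)    = refl
      xDist-shift (no _) (no j≢j)   = contradiction refl j≢j

    -- The port `x` itself is at 0 and meets only core vertices at 1. A port at 4 starts with `j`
    -- and hence meets only `y` with `j ∙ y ≡ s`, which `(i , j)` does not hit: it never meets a
    -- core vertex at 1.
    kindDist-port : ∀ {x y} → Hits x y →
                    Close (kindDist (s , i , j) (0F , x)) (kindDist (s , i , j) (1F , y))
    kindDist-port {x@(_ , i′ , _)} {y} h = cases ((s , i , j) ≟ⁱ x) (j ≟ᵛ i′) (hits? (s , i , j) y)
      where
      cases : (d : Dec ((s , i , j) ≡ x)) (e : Dec (j ≡ i′)) (f : Dec (Hits (s , i , j) y)) →
              Close (xDist d e) (yDist f)
      cases (yes refl) _ (yes _) = ℕ.z≤n , ℕₚ.≤-refl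
      cases (yes refl) _ (no ¬h) = contradiction h ¬h
      cases (no _) (yes _) (yes (_ , inj₁ i≡j)) = contradiction i≡j i≢j
      cases (no _) (yes refl) (yes (_ , inj₂ j∙y≢s)) = contradiction (proj₁ h) j∙y≢s
      cases (no _) (no _)  (yes _) = ℕₚ.≤-refl , ℕₚ.m≤m+n 1 2
      cases (no _) (yes _) (no _)  = ℕₚ.≤-refl , ℕₚ.m≤m+n 3 2
      cases (no _) (no _)  (no _)  = ℕₚ.m≤m+n 2 2 , ℕₚ.≤-refl

    kindDist-hub : ∀ y z → Close (kindDist (s , i , j) (1F , y)) (kindDist (s , i , j) (2F , z))
    kindDist-hub y z = cases (hits? (s , i , j) y)
      where
      cases : ∀ {A : Set} (f : Dec A) → Close (yDist f) 2
      cases (yes _) = ℕₚ.m≤m+n 1 2 , ℕₚ.≤-refl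
      cases (no _)  = ℕₚ.≤-refl , ℕₚ.m≤m+n 2 2

    dist : Cluster → Label → ℕ
    dist κ (κ′ , kx) = clusterDist κ κ′ ℕ.+ kindDist (s , i , j) kx

    -- Every arc changes only one of the two summands: it stays in a cluster, or it joins ports with
    -- the same index in two clusters.
    dist-arc : ∀ κ {u v} → Arc u v → Close (dist κ u) (dist κ v)
    dist-arc κ (port {κ′} {x} {y} h) = close-+ˡ (clusterDist κ κ′) (kindDist-port {x} {y} h)
    dist-arc κ (hub {κ′} {y} {z}) = close-+ˡ (clusterDist κ κ′) (kindDist-hub y z)
    dist-arc κ (cross {x = x}) = close-+ʳ (kindDist (s , i , j) (0F , x)) (clusterDist-lipschitz κ)

    dist-lipschitz : ∀ κ {u v} → Adjacent u v → dist κ v ≤ 1 ℕ.+ dist κ u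
    dist-lipschitz κ (inj₁ e) = proj₂ (dist-arc κ e)
    dist-lipschitz κ (inj₂ e) = proj₁ (dist-arc κ e)

    dist-self : ∀ κ → dist κ (κ , 0F , s , i , j) ≡ 0
    dist-self κ = cong₂ ℕ._+_ (clusterDist-refl κ) kindDist-refl

    dist-far : ∀ {b c d s′ k} → c ≢ d →
               dist (b , c) ((b , d) , 0F , s′ , j , k) ≡ 6
    dist-far {b} {s′ = s′} {k} c≢d = cong₂ ℕ._+_ (clusterDist-same-side {b} c≢d) (kindDist-shift {s′} {k})

  -- The blown-up graph: degrees and covers

  module _ (label : Fin n → Label) where

    pullback : Graph n
    pullback = record
      { adj = λ u v → does (adjacent? (label u) (label v))
      ; sym = λ u v → ∨-comm (does (arc? (label u) (label v))) _
      ; irr = λ u → dec-false (adjacent? (label u) (label u)) [ arc-irrefl , arc-irrefl ]′ }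

    -- A walk between the two edges would need length 6: it has to change the pair (i , j)
    -- inside one cluster, at cost 4, and to change the cluster but not the side, at cost 2.
    low-diameter-shift :
      (E : EdgeSet n) → (∀ u v → mem E u v ≡ true → adj pullback u v ≡ true) → DiamAtMost E 5 →
      ∀ {b c d s s′ i j k} → i ≢ j → c ≢ d → ∀ {u v} → Covered E u → Covered E v →
      label u ≡ ((b , c) , 0F , s , i , j) → label v ≢ ((b , d) , 0F , s′ , j , k)
    low-diameter-shift E E⊆ diam {b} {c} {d} {s} {s′} {i} {j} {k} i≢j c≢d {u} {v} cu cv eu ev =
      let l , l≤5 , walk = diam u v cu cv
          f = λ w → dist {s} {i} {j} i≢j (b , c) (label w)
          fv≤ = walk-bound f (λ x y xy → dist-lipschitz {s} i≢j (b , c)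
                  (does⇒ (adjacent? (label x) (label y)) (E⊆ x y xy))) walk
          fu≡0 = trans (cong (dist i≢j (b , c)) eu) (dist-self i≢j (b , c))
          fv≡6 = trans (cong (dist i≢j (b , c)) ev) (dist-far {s} i≢j {b} {s′ = s′} {k} c≢d)
      in ℕₚ.<⇒≱ (ℕ.s≤s l≤5) (ℕₚ.≤-trans (ℕₚ.≤-reflexive (≡-sym fv≡6))
           (ℕₚ.≤-trans fv≤ (ℕₚ.≤-reflexive (trans (cong (l ℕ.+_) fu≡0) (ℕₚ.+-identityʳ l)))))

    -- Every copy of a label from `neighbours` is adjacent to `u`, and the two Boolean tags form the
    -- `Fin 4` needed for counting.
    deg-pullback : ∀ {D} (copy : Label → Fin D → Fin n) → (∀ l d → label (copy l d) ≡ l) →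
                   (∀ {l l′ d d′} → copy l d ≡ copy l′ d′ → d ≡ d′) →
                   ∀ u → indices ℕ.* D ≤ deg pullback u ℕ.* 4
    deg-pullback {D} copy label-copy copy-inj u =
      length-filter-≥ (λ v → T? (adj pullback u v)) (↔-trans Finₚ.*↔× (Index↔ ×-↔ ↔-refl))
        f f-inj λ { (w , d) → Equivalence.from T-≡ (dec-true (adjacent? _ _)
          (subst (Adjacent (label u)) (≡-sym (label-copy (proj₁ (g w)) d)) (g-adj w))) }
      where
      g = proj₁ (neighbours (label u))
      g-inj = proj₁ (proj₂ (neighbours (label u)))
      g-adj = proj₂ (proj₂ (neighbours (label u)))
      tag : Fin 4 ↔ (Bool × Bool)
      tag = ↔-trans (Finₚ.*↔× {2}) (Finₚ.2↔Bool ×-↔ Finₚ.2↔Bool)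
      f : Index × Fin D → Fin n × Fin 4
      f (w , d) = copy (proj₁ (g w)) d , Inverse.from tag (proj₂ (g w))
      f-inj : Injective _≡_ _≡_ f
      f-inj {w , d} {w′ , d′} eq =
        let copy-eq , tag-eq = ×ₚ.,-injective eq
            label-eq = trans (≡-sym (label-copy _ d)) (trans (cong label copy-eq) (label-copy _ d′))
            bits-eq = Injection.injective (↔⇒↣ (↔-sym tag)) tag-eq
        in cong₂ _,_ (g-inj (cong₂ _,_ label-eq bits-eq)) (copy-inj copy-eq)

    -- For each (i , j), two of the t² cross edges lie in the same set of the cover.  Having two of them
    -- leaves, for any edge of an adjacent pair, one with different ends: the index of that set is a
    -- proper colouring of the shift graph.
    cover-large : (rep : Label → Fin n) → (∀ l → label (rep l) ≡ l) →
                  CoverableBy pullback 5 ℓ → ℓ < t ℕ.* t → 2 ℕ.^ q ≤ 2 ℕ.^ ℓ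
    cover-large {ℓ} rep label-rep (F , F⊆ , diam , covers) ℓ<t² =
      shift-colouring (λ i j → proj₁ (repeated (vec i) (vec j)))
        λ i j k i≢j → proper (i≢j ∘ Injection.injective (↔⇒↣ (Vec-Bool↔ q)))
                        (repeated _ _) (repeated _ _)
      where
      vec : Fin (2 ℕ.^ q) → Vec Bool q
      vec = Inverse.to (Vec-Bool↔ q)
      Cell : Set
      Cell = Fin t × Fin t
      left right : Cell → Vec Bool q → Vec Bool q → Fin n
      left  (c , _) i j = rep ((false , c) , 0F , false , i , j)
      right (_ , d) i j = rep ((true  , d) , 0F , false , i , j)

      covered : ∀ e i j → ∃ λ γ → mem (F γ) (left e i j) (right e i j) ≡ true
      covered (c , d) i j = covers _ _ (dec-true (adjacent? _ _)
        (inj₁ (subst₂ Arc (≡-sym (label-rep _)) (≡-sym (label-rep _)) cross)))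
      colour : Cell → Vec Bool q → Vec Bool q → Fin ℓ
      colour e i j = proj₁ (covered e i j)

      covered-left : ∀ {γ} e i j → colour e i j ≡ γ → Covered (F γ) (left e i j)
      covered-left e i j refl = _ , proj₂ (covered e i j)
      covered-right : ∀ {γ} e i j → colour e i j ≡ γ → Covered (F γ) (right e i j)
      covered-right e i j refl = _ , trans (msym (F _) _ _) (proj₂ (covered e i j))

      -- Different cells differ in their left or in their right cluster, and the two ends on that
      -- side contradict `low-diameter-shift`.
      no-clash : ∀ {γ} e e′ {i j k} → i ≢ j → e ≢ e′ → colour e i j ≡ γ → colour e′ j k ≢ γ
      no-clash {γ} e@(c , d) e′@(c′ , d′) {i} {j} {k} i≢j e≢e′ γ₁ γ₂ with c Finₚ.≟ c′ | d Finₚ.≟ d′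
      ... | yes refl | yes refl = e≢e′ refl
      ... | no c≢c′ | _ = low-diameter-shift (F γ) (F⊆ γ) (diam γ) i≢j c≢c′
              (covered-left e i j γ₁) (covered-left e′ j k γ₂) (label-rep _) (label-rep _)
      ... | _ | no d≢d′ = low-diameter-shift (F γ) (F⊆ γ) (diam γ) i≢j d≢d′
              (covered-right e i j γ₁) (covered-right e′ j k γ₂) (label-rep _) (label-rep _)

      Repeated : Vec Bool q → Vec Bool q → Set
      Repeated i j = ∃ λ γ → ∃₂ λ e e′ → e ≢ e′ × colour e i j ≡ γ × colour e′ i j ≡ γ
      repeated : ∀ i j → Repeated i j
      repeated i j =
        let x , y , x<y , eq = Finₚ.pigeonhole ℓ<t² (λ z → colour (remQuot t z) i j)
        in _ , remQuot t x , remQuot t y ,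
           (λ e → Finₚ.<⇒≢ x<y (Injection.injective (↔⇒↣ (Finₚ.*↔× {t} {t})) e)) , refl , ≡-sym eq

      proper : ∀ {i j k} → i ≢ j → (ρ : Repeated i j) (σ : Repeated j k) → proj₁ ρ ≢ proj₁ σ
      proper i≢j (γ , e , _ , _ , γ₁ , _) (_ , e₁ , e₂ , e₁≢e₂ , γ₂ , γ₃) refl
        with ×ₚ.≡-dec Finₚ._≟_ Finₚ._≟_ e e₁
      ... | no e≢e₁  = no-clash e e₁ i≢j e≢e₁ γ₁ γ₂
      ... | yes refl = no-clash e e₂ i≢j e₁≢e₂ γ₁ γ₃

-- Hard graphs for every large number of vertices

n≤2^n : ∀ n → n ≤ 2 ℕ.^ n
n≤2^n ℕ.zero    = ℕ.z≤n
n≤2^n (ℕ.suc n) = ℕₚ.+-mono-≤ (ℕₚ.m^n>0 2 n) (ℕₚ.≤-trans (n≤2^n n) (ℕₚ.m≤m+n _ 0))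

module _ (t : ℕ) where

  -- Vectors of length t² give 2 to the t² indices, too many for a proper colouring with fewer than
  -- t² colours.
  open Labels t (t ℕ.* t)

  labels : ℕ
  labels = clusters ℕ.* (3 ℕ.* indices)

  -- The factor `48 ℕ.* t` is made of 2t clusters, 3 kinds, 4 for the density 1/4, and 2 for the
  -- vertices left over by the blow-up.
  HardGraph : ℕ → Set
  HardGraph n = Σ (Graph n) λ G → (∀ u → n ≤ 48 ℕ.* t ℕ.* deg G u) ×
                      (∀ ℓ → CoverableBy G 5 ℓ → t ℕ.* t ≤ ℓ)

  labels-positive : 1 ≤ t → 1 ≤ labels
  labels-positive t≥1 = ℕₚ.*-mono-≤ {1} {clusters} (ℕₚ.≤-trans t≥1 (ℕₚ.m≤m+n t _))
    (ℕₚ.*-mono-≤ {1} {3} (ℕ.s≤s ℕ.z≤n) (ℕₚ.*-mono-≤ {1} {2} (ℕ.s≤s ℕ.z≤n)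
      (ℕₚ.*-mono-≤ (ℕₚ.m^n>0 2 (t ℕ.* t)) (ℕₚ.m^n>0 2 (t ℕ.* t)))))

  -- As every label has a copy, the remainder `r` at most doubles the number of vertices, and
  -- `cop l 0F` can represent `l`.
  blowup-hard : ∀ r D → .{{_ : ℕ.NonZero labels}} → r < labels → HardGraph (r ℕ.+ ℕ.suc D ℕ.* labels)
  blowup-hard r D r<M = pullback lab , degrees , hard
    where
    D′ = ℕ.suc D
    open Blowup (blowup r D′ labels)
    lab : Fin (r ℕ.+ D′ ℕ.* labels) → Label
    lab = Inverse.to Label↔ ∘ label
    cop : Label → Fin D′ → Fin (r ℕ.+ D′ ℕ.* labels)
    cop l = copy (Inverse.from Label↔ l)
    lab-cop : ∀ l d → lab (cop l d) ≡ l
    lab-cop l d = trans (cong (Inverse.to Label↔) (label-copy _ d)) (Inverse.strictlyInverseˡ Label↔ l)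
    degrees : ∀ u → r ℕ.+ D′ ℕ.* labels ≤ 48 ℕ.* t ℕ.* deg (pullback lab) u
    degrees u = begin
      r ℕ.+ D′ ℕ.* labels                     ≤⟨ ℕₚ.+-monoˡ-≤ _ (ℕₚ.<⇒≤ r<M) ⟩
      labels ℕ.+ D′ ℕ.* labels                ≤⟨ ℕₚ.+-monoˡ-≤ _ (ℕₚ.m≤m+n labels _) ⟩
      D′ ℕ.* labels ℕ.+ D′ ℕ.* labels         ≡⟨ regroup t indices D′ ⟩
      12 ℕ.* t ℕ.* (indices ℕ.* D′)           ≤⟨ ℕₚ.*-monoʳ-≤ (12 ℕ.* t)
                                                  (deg-pullback lab cop lab-cop copy-inj u) ⟩
      12 ℕ.* t ℕ.* (deg (pullback lab) u ℕ.* 4) ≡⟨ regroup′ t (deg (pullback lab) u) ⟩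
      48 ℕ.* t ℕ.* deg (pullback lab) u       ∎
      where
      open ℕₚ.≤-Reasoning
      regroup : ∀ t i D → D ℕ.* (2 ℕ.* t ℕ.* (3 ℕ.* i)) ℕ.+ D ℕ.* (2 ℕ.* t ℕ.* (3 ℕ.* i)) ≡
                          12 ℕ.* t ℕ.* (i ℕ.* D)
      regroup = solve-∀
      regroup′ : ∀ t d → 12 ℕ.* t ℕ.* (d ℕ.* 4) ≡ 48 ℕ.* t ℕ.* d
      regroup′ = solve-∀
    hard : ∀ ℓ → CoverableBy (pullback lab) 5 ℓ → t ℕ.* t ≤ ℓ
    hard ℓ cover = ℕₚ.≮⇒≥ λ ℓ<t² → ℕₚ.<⇒≱ (ℕₚ.^-monoʳ-< 2 (ℕ.s≤s (ℕ.s≤s ℕ.z≤n)) ℓ<t²)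
      (cover-large lab (λ l → cop l 0F) (λ l → lab-cop l 0F) cover ℓ<t²)

  hard-graph : 1 ≤ t → ∀ n → labels ≤ n → HardGraph n
  hard-graph t≥1 n M≤n = subst HardGraph (≡-sym n≡)
    (blowup-hard (n DivMod.% labels) (ℕ.pred (n DivMod./ labels)) (DivMod.m%n<n n labels))
    where
    instance
      M≢0 : ℕ.NonZero labels
      M≢0 = ℕ.>-nonZero (labels-positive t≥1)
      D≢0 : ℕ.NonZero (n DivMod./ labels)
      D≢0 = ℕ.>-nonZero (DivMod.m≥n⇒m/n>0 M≤n)
    n≡ : n ≡ n DivMod.% labels ℕ.+ ℕ.suc (ℕ.pred (n DivMod./ labels)) ℕ.* labels
    n≡ = trans (DivMod.m≡m%n+[m/n]*n n labels)
      (cong (λ D → n DivMod.% labels ℕ.+ D ℕ.* labels) (≡-sym (ℕₚ.suc-pred (n DivMod./ labels))))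

  -- The right side is what the hypothesis on log n provides when 48t ≤ 1/ε. Bounding 12 by 2 to the
  -- 4 and `t` by 2 to the `t` leaves the exponent 4 + t + 2t² on the left.
  labels-bound : 1 ≤ t → labels ≤ 2 ℕ.^ (48 ℕ.* t ℕ.* (48 ℕ.* t) ℕ.* (48 ℕ.* t))
  labels-bound t≥1@(ℕ.s≤s _) = begin
    labels                                            ≡⟨ regroup t (2 ℕ.^ (t ℕ.* t)) ⟩
    12 ℕ.* (t ℕ.* (2 ℕ.^ (t ℕ.* t) ℕ.* 2 ℕ.^ (t ℕ.* t)))
      ≤⟨ ℕₚ.*-mono-≤ (ℕₚ.m≤m+n 12 4) (ℕₚ.*-monoˡ-≤ _ (n≤2^n t)) ⟩
    2 ℕ.^ 4 ℕ.* (2 ℕ.^ t ℕ.* (2 ℕ.^ (t ℕ.* t) ℕ.* 2 ℕ.^ (t ℕ.* t)))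
      ≡⟨ cong (λ z → 2 ℕ.^ 4 ℕ.* (2 ℕ.^ t ℕ.* z)) (ℕₚ.^-distribˡ-+-* 2 (t ℕ.* t) (t ℕ.* t)) ⟨
    2 ℕ.^ 4 ℕ.* (2 ℕ.^ t ℕ.* 2 ℕ.^ (t ℕ.* t ℕ.+ t ℕ.* t))
      ≡⟨ cong (2 ℕ.^ 4 ℕ.*_) (ℕₚ.^-distribˡ-+-* 2 t _) ⟨
    2 ℕ.^ 4 ℕ.* 2 ℕ.^ (t ℕ.+ (t ℕ.* t ℕ.+ t ℕ.* t))
      ≡⟨ ℕₚ.^-distribˡ-+-* 2 4 (t ℕ.+ (t ℕ.* t ℕ.+ t ℕ.* t)) ⟨
    2 ℕ.^ (4 ℕ.+ (t ℕ.+ (t ℕ.* t ℕ.+ t ℕ.* t)))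
      ≤⟨ ℕₚ.^-monoʳ-≤ 2 exponent ⟩
    2 ℕ.^ (48 ℕ.* t ℕ.* (48 ℕ.* t) ℕ.* (48 ℕ.* t))     ∎
    where
    open ℕₚ.≤-Reasoning
    regroup : ∀ t w → 2 ℕ.* t ℕ.* (3 ℕ.* (2 ℕ.* (w ℕ.* w))) ≡ 12 ℕ.* (t ℕ.* (w ℕ.* w))
    regroup = solve-∀
    t³ = t ℕ.* t ℕ.* t
    t²≤t³ : t ℕ.* t ≤ t³
    t²≤t³ = ℕₚ.m≤m*n (t ℕ.* t) t
    t≤t³ : t ≤ t³
    t≤t³ = ℕₚ.≤-trans (ℕₚ.m≤m*n t t) t²≤t³
    sum : ∀ s → 4 ℕ.* s ℕ.+ (s ℕ.+ (s ℕ.+ s)) ≡ 7 ℕ.* s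
    sum = solve-∀
    expand : ∀ c t → c ℕ.* c ℕ.* c ℕ.* (t ℕ.* t ℕ.* t) ≡ c ℕ.* t ℕ.* (c ℕ.* t) ℕ.* (c ℕ.* t)
    expand = solve-∀
    exponent : 4 ℕ.+ (t ℕ.+ (t ℕ.* t ℕ.+ t ℕ.* t)) ≤ 48 ℕ.* t ℕ.* (48 ℕ.* t) ℕ.* (48 ℕ.* t)
    exponent = begin
      4 ℕ.+ (t ℕ.+ (t ℕ.* t ℕ.+ t ℕ.* t))
        ≤⟨ ℕₚ.+-mono-≤ (ℕₚ.*-monoʳ-≤ 4 (ℕₚ.≤-trans t≥1 t≤t³))
                       (ℕₚ.+-mono-≤ t≤t³ (ℕₚ.+-mono-≤ t²≤t³ t²≤t³)) ⟩
      4 ℕ.* t³ ℕ.+ (t³ ℕ.+ (t³ ℕ.+ t³))                ≡⟨ sum t³ ⟩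
      -- The sum 7 + 110585 is the cube of 48.
      7 ℕ.* t³                                       ≤⟨ ℕₚ.*-monoˡ-≤ t³ (ℕₚ.m≤m+n 7 110585) ⟩
      48 ℕ.* 48 ℕ.* 48 ℕ.* t³                          ≡⟨ expand 48 t ⟩
      48 ℕ.* t ℕ.* (48 ℕ.* t) ℕ.* (48 ℕ.* t)            ∎

-- Complete graphs, which force covers to be nonempty

complete : ∀ n → Graph n
complete n = record
  { adj = λ u v → does (¬? (u Finₚ.≟ v))
  ; sym = λ u v → cong not (does-sym (u Finₚ.≟ v) (v Finₚ.≟ u))
  ; irr = λ u → cong not (dec-true (u Finₚ.≟ u) refl) }
  where
  does-sym : ∀ {u v : Fin n} (d : Dec (u ≡ v)) (e : Dec (v ≡ u)) → does d ≡ does e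
  does-sym (yes u≡v) e = ≡-sym (dec-true e (≡-sym u≡v))
  does-sym (no u≢v)  e = ≡-sym (dec-false e (u≢v ∘ ≡-sym))

deg-complete : ∀ n u → n ≤ deg (complete (ℕ.suc n)) u
deg-complete n u = ℕₚ.≤-trans
  (length-filter-≥ {r = 1} (λ v → T? (adj (complete (ℕ.suc n)) u v)) ↔-refl (λ i → punchIn u i , 0F)
    (λ eq → Finₚ.punchIn-injective u _ _ (cong proj₁ eq))
    λ i → Equivalence.from T-≡ (dec-true (¬? (u Finₚ.≟ punchIn u i)) (Finₚ.punchInᵢ≢i u i ∘ ≡-sym)))
  (ℕₚ.≤-reflexive (ℕₚ.*-identityʳ _))

-- Naturals as rationals, logarithms and rounding

toℚᵘ-ℕ→ℚ : ∀ n → ℚ.toℚᵘ (ℕ→ℚ n) ℚᵘ.≃ mkℚᵘ (+ n) 0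
toℚᵘ-ℕ→ℚ n = ℚₚ.toℚᵘ-fromℚᵘ (mkℚᵘ (+ n) 0)

ℕ→ℚ-mul : ∀ m n → ℕ→ℚ (m ℕ.* n) ≡ ℕ→ℚ m * ℕ→ℚ n
ℕ→ℚ-mul m n = ℚₚ.toℚᵘ-injective (ℚᵘₚ.≃-trans (toℚᵘ-ℕ→ℚ (m ℕ.* n))
  (ℚᵘₚ.≃-sym (ℚᵘₚ.≃-trans (ℚₚ.toℚᵘ-homo-* (ℕ→ℚ m) (ℕ→ℚ n))
  (ℚᵘₚ.≃-trans (ℚᵘₚ.*-cong (toℚᵘ-ℕ→ℚ m) (toℚᵘ-ℕ→ℚ n))
    (ℚᵘ.*≡* (cong (ℤ._* + 1) (≡-sym (ℤₚ.pos-* m n))))))))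

ℕ→ℚ-suc : ∀ n → ℕ→ℚ (ℕ.suc n) -ℚ ℕ→ℚ 1 ≡ ℕ→ℚ n
ℕ→ℚ-suc n = trans (cong (_-ℚ ℕ→ℚ 1) suc≡) (trans (ℚₚ.+-assoc (ℕ→ℚ n) (ℕ→ℚ 1) (ℚ.- ℕ→ℚ 1))
    (trans (cong (ℕ→ℚ n ℚ.+_) (ℚₚ.+-inverseʳ (ℕ→ℚ 1))) (ℚₚ.+-identityʳ (ℕ→ℚ n))))
  where
  suc≡ : ℕ→ℚ (ℕ.suc n) ≡ ℕ→ℚ n ℚ.+ ℕ→ℚ 1
  suc≡ = ℚₚ.toℚᵘ-injective (ℚᵘₚ.≃-trans (toℚᵘ-ℕ→ℚ (ℕ.suc n))
    (ℚᵘₚ.≃-sym (ℚᵘₚ.≃-trans (ℚₚ.toℚᵘ-homo-+ (ℕ→ℚ n) (ℕ→ℚ 1))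
    (ℚᵘₚ.≃-trans (ℚᵘₚ.+-cong (toℚᵘ-ℕ→ℚ n) (toℚᵘ-ℕ→ℚ 1))
      (ℚᵘ.*≡* (cong (ℤ._* + 1) (trans (cong (ℤ._+ + 1) (ℤₚ.*-identityʳ (+ n)))
                                          (cong +_ (ℕₚ.+-comm n 1)))))))))

ℕ→ℚ-mono-≤ : m ≤ n → ℕ→ℚ m ≤ℚ ℕ→ℚ n
ℕ→ℚ-mono-≤ {m} {n} m≤n = ℚₚ.toℚᵘ-cancel-≤ (ℚᵘₚ.≤-respˡ-≃ (ℚᵘₚ.≃-sym (toℚᵘ-ℕ→ℚ m))
  (ℚᵘₚ.≤-respʳ-≃ (ℚᵘₚ.≃-sym (toℚᵘ-ℕ→ℚ n)) (ℚᵘ.*≤* (ℤₚ.*-monoʳ-≤-nonNeg (+ 1) (ℤ.+≤+ m≤n)))))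

ℕ→ℚ-nonNeg : ∀ n → ℚ.NonNegative (ℕ→ℚ n)
ℕ→ℚ-nonNeg n = ℚ.nonNegative (ℕ→ℚ-mono-≤ (ℕ.z≤n {n}))

ℕ→ℚ-≤⁻ : ∀ k x → ℕ→ℚ k ≤ℚ x → + k ℤ.* ℚ.↧ x ℤ.≤ ℚ.↥ x
ℕ→ℚ-≤⁻ k x@(mkℚ _ _ _) k≤x with ℚᵘₚ.≤-respˡ-≃ (toℚᵘ-ℕ→ℚ k) (ℚₚ.toℚᵘ-mono-≤ k≤x)
... | ℚᵘ.*≤* le = subst (+ k ℤ.* ℚ.↧ x ℤ.≤_) (ℤₚ.*-identityʳ (ℚ.↥ x)) le

-- For x = p/(d+1) at least K, 2 to the p is at least the power `suc d` of 2 to the K, so n below 2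
-- to the K is impossible.
log-bound : ∀ K n x → ℕ→ℚ K ≤ℚ x → x <log₂ n → 2 ℕ.^ K ≤ n
log-bound K n x K≤x (inj₁ (x<0 , _)) =
  contradiction (ℚₚ.<-≤-trans x<0 (ℚₚ.≤-trans (ℕ→ℚ-mono-≤ (ℕ.z≤n {K})) K≤x)) (ℚₚ.<-irrefl refl)
log-bound K n x@(mkℚ (+ p) d _) K≤x (inj₂ (_ , lt)) = ℕₚ.≮⇒≥ λ n<2^K →
  ℕₚ.<⇒≱ lt (begin
    n ℕ.^ ℕ.suc d             ≤⟨ ℕₚ.^-monoˡ-≤ (ℕ.suc d) (ℕₚ.<⇒≤ n<2^K) ⟩
    (2 ℕ.^ K) ℕ.^ ℕ.suc d     ≡⟨ ℕₚ.^-*-assoc 2 K (ℕ.suc d) ⟩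
    2 ℕ.^ (K ℕ.* ℕ.suc d)     ≤⟨ ℕₚ.^-monoʳ-≤ 2 Kd≤p ⟩
    2 ℕ.^ p                   ∎)
  where
  open ℕₚ.≤-Reasoning
  Kd≤p : K ℕ.* ℕ.suc d ≤ p
  Kd≤p = ℤₚ.drop‿+≤+ (subst (ℤ._≤ + p) (≡-sym (ℤₚ.pos-* K (ℕ.suc d))) (ℕ→ℚ-≤⁻ K x K≤x))
log-bound K n (mkℚ ℤ.-[1+ p ] d _) K≤x (inj₂ (ℚ.*≤* () , _))

-- The witness is the floor of 1/(kε). With ε = a/b it is the quotient of b by ka, and both
-- inequalities are those of division with remainder.
floor-reciprocal : ∀ ε → 0ℚ <ℚ ε → ∀ k .{{_ : ℕ.NonZero k}} →
                   ∃ λ t → ℕ→ℚ (k ℕ.* t) * ε ≤ℚ ℚ.1ℚ × ℚ.1ℚ <ℚ ℕ→ℚ (k ℕ.* ℕ.suc t) * ε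
floor-reciprocal (mkℚ (+ ℕ.zero) d _) (ℚ.*<* (ℤ.+<+ ()))
floor-reciprocal (mkℚ ℤ.-[1+ a ] d _) (ℚ.*<* ())
floor-reciprocal ε@(mkℚ (+ a@(ℕ.suc _)) d _) _ k = t , lower , upper
  where
  b = ℕ.suc d
  instance
    ka≢0 : ℕ.NonZero (k ℕ.* a)
    ka≢0 = ℕₚ.m*n≢0 k a
  t = b DivMod./ (k ℕ.* a)
  swapʳ : ∀ t → k ℕ.* t ℕ.* a ≡ t ℕ.* (k ℕ.* a)
  swapʳ t = trans (cong (ℕ._* a) (ℕₚ.*-comm k t)) (ℕₚ.*-assoc t k a)
  product : ∀ m → ℚ.toℚᵘ (ℕ→ℚ m * ε) ℚᵘ.≃ mkℚᵘ (+ m) 0 ℚᵘ.* mkℚᵘ (+ a) d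
  product m = ℚᵘₚ.≃-trans (ℚₚ.toℚᵘ-homo-* (ℕ→ℚ m) ε) (ℚᵘₚ.*-cong (toℚᵘ-ℕ→ℚ m) ℚᵘₚ.≃-refl)
  numerator : ∀ m → + (m ℕ.* a) ≡ + m ℤ.* + a ℤ.* + 1
  numerator m = trans (ℤₚ.pos-* m a) (≡-sym (ℤₚ.*-identityʳ _))
  denominator : + b ≡ + 1 ℤ.* + (1 ℕ.* b)
  denominator = trans (cong +_ (≡-sym (ℕₚ.*-identityˡ b))) (≡-sym (ℤₚ.*-identityˡ _))
  lower : ℕ→ℚ (k ℕ.* t) * ε ≤ℚ ℚ.1ℚ
  lower = ℚₚ.toℚᵘ-cancel-≤ (ℚᵘₚ.≤-respˡ-≃ (ℚᵘₚ.≃-sym (product (k ℕ.* t)))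
    (ℚᵘ.*≤* (subst₂ ℤ._≤_ (numerator (k ℕ.* t)) denominator (ℤ.+≤+ le))))
    where
    le : k ℕ.* t ℕ.* a ≤ b
    le = ℕₚ.≤-trans (ℕₚ.≤-reflexive (swapʳ t)) (DivMod.m/n*n≤m b (k ℕ.* a))
  upper : ℚ.1ℚ <ℚ ℕ→ℚ (k ℕ.* ℕ.suc t) * ε
  upper = ℚₚ.toℚᵘ-cancel-< (ℚᵘₚ.<-respʳ-≃ (ℚᵘₚ.≃-sym (product (k ℕ.* ℕ.suc t)))
    (ℚᵘ.*<* (subst₂ ℤ._<_ denominator (numerator (k ℕ.* ℕ.suc t)) (ℤ.+<+ lt))))
    where
    open ℕₚ.≤-Reasoning
    lt : b < k ℕ.* ℕ.suc t ℕ.* a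
    lt = begin-strict
      b                                              ≡⟨ DivMod.m≡m%n+[m/n]*n b (k ℕ.* a) ⟩
      b DivMod.% (k ℕ.* a) ℕ.+ t ℕ.* (k ℕ.* a)           <⟨ ℕₚ.+-monoˡ-< _ (DivMod.m%n<n b (k ℕ.* a)) ⟩
      ℕ.suc t ℕ.* (k ℕ.* a)                            ≡⟨ swapʳ (ℕ.suc t) ⟨
      k ℕ.* ℕ.suc t ℕ.* a                              ∎

square-mono-≤ : ∀ {x y} → 0ℚ ≤ℚ x → x ≤ℚ y → x * x ≤ℚ y * y
square-mono-≤ {x} {y} 0≤x x≤y = ℚₚ.≤-trans (ℚₚ.*-monoˡ-≤-nonNeg x x≤y) (ℚₚ.*-monoʳ-≤-nonNeg y x≤y)
  where
  instance
    _ = ℚ.nonNegative 0≤x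
    _ = ℚ.nonNegative (ℚₚ.≤-trans 0≤x x≤y)

cube-mono-≤ : ∀ {x y} → 0ℚ ≤ℚ x → x ≤ℚ y → cube x ≤ℚ cube y
cube-mono-≤ {x} {y} 0≤x x≤y =
  ℚₚ.≤-trans (ℚₚ.*-monoʳ-≤-nonNeg x (square-mono-≤ 0≤x x≤y)) (ℚₚ.*-monoˡ-≤-nonNeg (y * y) x≤y)
  where
  instance
    _ = ℚ.nonNegative 0≤x
    y≥0 = ℚ.nonNegative (ℚₚ.≤-trans 0≤x x≤y)
    _ = ℚₚ.nonNeg*nonNeg⇒nonNeg y y

1/-nonNeg : ∀ x .{{_ : ℚ.Positive x}} .{{_ : ℚ.NonZero x}} → ℚ.NonNegative (ℚ.1/ x)
1/-nonNeg (mkℚ (+ ℕ.suc _) _ _) = _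

-- Bounds in terms of ε

module _ {ε : ℚ} (ε>0 : 0ℚ <ℚ ε) where

  private instance
    ε-pos : ℚ.Positive ε
    ε-pos = ℚ.positive ε>0
    ε≢0 : ℚ.NonZero ε
    ε≢0 = >-nonZero ε>0
    ε-nonNeg : ℚ.NonNegative ε
    ε-nonNeg = ℚₚ.pos⇒nonNeg ε
    1/ε-nonNeg : ℚ.NonNegative (ℚ.1/ ε)
    1/ε-nonNeg = 1/-nonNeg ε

  ≤-reciprocal : ∀ {x} → x * ε ≤ℚ ℚ.1ℚ → x ≤ℚ ℚ.1ℚ ÷ ε
  ≤-reciprocal {x} xε≤1 = begin
    x                       ≡⟨ ℚₚ.*-identityʳ x ⟨
    x * ℚ.1ℚ                 ≡⟨ cong (x *_) (ℚₚ.*-inverseʳ ε) ⟨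
    x * (ε * (ℚ.1/ ε))       ≡⟨ ℚₚ.*-assoc x ε (ℚ.1/ ε) ⟨
    x * ε * (ℚ.1/ ε)         ≤⟨ ℚₚ.*-monoʳ-≤-nonNeg (ℚ.1/ ε) xε≤1 ⟩
    ℚ.1ℚ ÷ ε                 ∎
    where open ℚₚ.≤-Reasoning

  min-degree : ∀ {k n d} → ℕ→ℚ k * ε ≤ℚ ℚ.1ℚ → n ≤ k ℕ.* d → ε * ℕ→ℚ n ≤ℚ ℕ→ℚ d
  min-degree {k} {n} {d} kε≤1 n≤kd = begin
    ε * ℕ→ℚ n               ≤⟨ ℚₚ.*-monoˡ-≤-nonNeg ε (ℕ→ℚ-mono-≤ n≤kd) ⟩
    ε * ℕ→ℚ (k ℕ.* d)       ≡⟨ cong (ε *_) (ℕ→ℚ-mul k d) ⟩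
    ε * (ℕ→ℚ k * ℕ→ℚ d)     ≡⟨ ℚₚ.*-assoc ε (ℕ→ℚ k) (ℕ→ℚ d) ⟨
    ε * ℕ→ℚ k * ℕ→ℚ d       ≡⟨ cong (_* ℕ→ℚ d) (ℚₚ.*-comm ε (ℕ→ℚ k)) ⟩
    ℕ→ℚ k * ε * ℕ→ℚ d       ≤⟨ ℚₚ.*-monoʳ-≤-nonNeg (ℕ→ℚ d) {{ℕ→ℚ-nonNeg d}} kε≤1 ⟩
    ℚ.1ℚ * ℕ→ℚ d             ≡⟨ ℚₚ.*-identityˡ (ℕ→ℚ d) ⟩
    ℕ→ℚ d                   ∎
    where open ℚₚ.≤-Reasoning

  -- The hypothesis εn ≤ n - 1 admits the complete graph, whose edge `0F`, `1F` needs a set. It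
  -- rules out n = 0, where it reads 0 ≤ -1, and n = 1, where it reads ε ≤ 0.
  covers-nonempty : ∀ n q → ε * ℕ→ℚ n ≤ℚ ℕ→ℚ n -ℚ ℕ→ℚ 1 → QWorks n ε 5 q → 1 ≤ q
  covers-nonempty ℕ.zero q εn≤ _ = contradiction
    (ℚₚ.≤-trans (ℚₚ.≤-reflexive (≡-sym (ℚₚ.*-zeroʳ ε))) εn≤) λ { (ℚ.*≤* ()) }
  covers-nonempty (ℕ.suc ℕ.zero) q εn≤ _ = contradiction
    (ℚₚ.<-≤-trans ε>0 (ℚₚ.≤-trans (ℚₚ.≤-reflexive (≡-sym (ℚₚ.*-identityʳ ε))) εn≤)) (ℚₚ.<-irrefl refl)
  covers-nonempty (ℕ.suc n@(ℕ.suc _)) q εn≤ works =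
    let _ , _ , _ , covers = works (complete (ℕ.suc n)) λ u →
          ℚₚ.≤-trans εn≤ (ℚₚ.≤-trans (ℚₚ.≤-reflexive (ℕ→ℚ-suc n)) (ℕ→ℚ-mono-≤ (deg-complete n u)))
    in ℕₚ.≤-trans (ℕ.s≤s ℕ.z≤n) (Finₚ.toℕ<n (proj₁ (covers 0F 1F refl)))

  -- From 48t ≤ 1/ε it follows that log n is at least the cube of 48t, so `n` is large enough for
  -- `hard-graph`.
  covers-quadratic : ∀ t n q → ℕ→ℚ (48 ℕ.* t) * ε ≤ℚ ℚ.1ℚ → cube (ℚ.1ℚ ÷ ε) <log₂ n →
                     QWorks n ε 5 q → t ℕ.* t ≤ q
  covers-quadratic ℕ.zero _ _ _ _ _ = ℕ.z≤n
  covers-quadratic t@(ℕ.suc _) n q Kε≤1 large works =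
    let G , degrees , hard = hard-graph t t≥1 n
          (ℕₚ.≤-trans (labels-bound t t≥1) (log-bound (K ℕ.* K ℕ.* K) n _ K³≤ large))
    in hard q (works G λ u → min-degree {K} Kε≤1 (degrees u))
    where
    K = 48 ℕ.* t
    t≥1 : 1 ≤ t
    t≥1 = ℕ.s≤s ℕ.z≤n
    K³≤ : ℕ→ℚ (K ℕ.* K ℕ.* K) ≤ℚ cube (ℚ.1ℚ ÷ ε)
    K³≤ = ℚₚ.≤-trans
      (ℚₚ.≤-reflexive (trans (ℕ→ℚ-mul (K ℕ.* K) K) (cong (_* ℕ→ℚ K) (ℕ→ℚ-mul K K))))
      (cube-mono-≤ (ℕ→ℚ-mono-≤ (ℕ.z≤n {K})) (≤-reciprocal Kε≤1))

  -- As 1 < kε, also 1 < (kε)², and this is at most 9216 q ε².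
  quadratic-bound : ∀ k q → ℚ.1ℚ <ℚ ℕ→ℚ k * ε → k ℕ.* k ≤ 9216 ℕ.* q →
                    + 1 ℚ./ 9216 <ℚ ℕ→ℚ q * (ε * ε)
  quadratic-bound k q 1<kε k²≤ = begin-strict
    c                                 ≡⟨ ℚₚ.*-identityʳ c ⟨
    c * ℚ.1ℚ                           <⟨ ℚₚ.*-monoʳ-<-pos c (ℚₚ.<-≤-trans 1<kε kε≤) ⟩
    c * (kε * kε)                     ≡⟨ cong (c *_) (interchange (ℕ→ℚ k) ε (ℕ→ℚ k) ε) ⟩
    c * (ℕ→ℚ k * ℕ→ℚ k * (ε * ε))     ≡⟨ cong (λ z → c * (z * (ε * ε))) (ℕ→ℚ-mul k k) ⟨
    c * (ℕ→ℚ (k ℕ.* k) * (ε * ε))     ≤⟨ ℚₚ.*-monoˡ-≤-nonNeg c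
                                            (ℚₚ.*-monoʳ-≤-nonNeg (ε * ε) {{ε²-nonNeg}} (ℕ→ℚ-mono-≤ k²≤)) ⟩
    c * (ℕ→ℚ (9216 ℕ.* q) * (ε * ε))  ≡⟨ cong (λ z → c * (z * (ε * ε))) (ℕ→ℚ-mul 9216 q) ⟩
    c * (ℕ→ℚ 9216 * ℕ→ℚ q * (ε * ε))  ≡⟨ cong (c *_) (ℚₚ.*-assoc (ℕ→ℚ 9216) (ℕ→ℚ q) (ε * ε)) ⟩
    c * (ℕ→ℚ 9216 * (ℕ→ℚ q * (ε * ε))) ≡⟨ ℚₚ.*-assoc c (ℕ→ℚ 9216) (ℕ→ℚ q * (ε * ε)) ⟨
    -- The product `c * ℕ→ℚ 9216` evaluates to `1ℚ`.
    ℚ.1ℚ * (ℕ→ℚ q * (ε * ε))           ≡⟨ ℚₚ.*-identityˡ (ℕ→ℚ q * (ε * ε)) ⟩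
    ℕ→ℚ q * (ε * ε)                   ∎
    where
    open ℚₚ.≤-Reasoning
    open import Algebra.Properties.CommutativeSemigroup
      (CommutativeMonoid.commutativeSemigroup ℚₚ.*-1-commutativeMonoid) using (interchange)
    c = + 1 ℚ./ 9216
    kε = ℕ→ℚ k * ε
    ε²-nonNeg : ℚ.NonNegative (ε * ε)
    ε²-nonNeg = ℚₚ.nonNeg*nonNeg⇒nonNeg ε ε
    kε≤ : kε ≤ℚ kε * kε
    kε≤ = ℚₚ.≤-trans (ℚₚ.≤-reflexive (≡-sym (ℚₚ.*-identityʳ kε)))
      (ℚₚ.*-monoˡ-≤-nonNeg kε {{ℚ.nonNegative (ℚₚ.<⇒≤ (ℚₚ.<-trans (ℚₚ.positive⁻¹ ℚ.1ℚ) 1<kε))}}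
        (ℚₚ.<⇒≤ 1<kε))

-- For t ≥ 1, rounding costs t + 1 ≤ 2t, which gives 9216 = 96². For t = 0 the bound t² ≤ q is empty
-- and `1 ≤ q` takes its place.
square-bound : ∀ t q → 1 ≤ q → t ℕ.* t ≤ q → 48 ℕ.* ℕ.suc t ℕ.* (48 ℕ.* ℕ.suc t) ≤ 9216 ℕ.* q
square-bound ℕ.zero q 1≤q _ = ℕₚ.*-mono-≤ (ℕₚ.m≤m+n 2304 6912) 1≤q
square-bound t@(ℕ.suc t′) q _ t²≤q = begin
  48 ℕ.* ℕ.suc t ℕ.* (48 ℕ.* ℕ.suc t)   ≤⟨ ℕₚ.*-mono-≤ doubling doubling ⟩
  96 ℕ.* t ℕ.* (96 ℕ.* t)               ≡⟨ regroup 96 t ⟩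
  9216 ℕ.* (t ℕ.* t)                   ≤⟨ ℕₚ.*-monoʳ-≤ 9216 t²≤q ⟩
  9216 ℕ.* q                           ∎
  where
  open ℕₚ.≤-Reasoning
  doubling : 48 ℕ.* ℕ.suc t ≤ 96 ℕ.* t
  doubling = ℕₚ.≤-trans (ℕₚ.*-monoʳ-≤ 48 (ℕₚ.+-monoˡ-≤ t (ℕ.s≤s (ℕ.z≤n {t′}))))
    (ℕₚ.≤-reflexive (twice 48 t))
    where
    twice : ∀ c t → c ℕ.* (t ℕ.+ t) ≡ (c ℕ.+ c) ℕ.* t
    twice = solve-∀
  regroup : ∀ c t → c ℕ.* t ℕ.* (c ℕ.* t) ≡ c ℕ.* c ℕ.* (t ℕ.* t)
  regroup = solve-∀

theorem3p6 : ∃[ c ] ∃[ c' ] (0ℚ <ℚ c × 0ℚ <ℚ c' ×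
    ((n : ℕ) (ε : ℚ) (ε>0 : 0ℚ <ℚ ε) →
    ε * ℕ→ℚ n ≤ℚ ℕ→ℚ n -ℚ ℕ→ℚ 1 →
    cube ((c' ÷ ε) {{>-nonZero ε>0}}) <log₂ n →
    (q : ℕ) → IsQ n ε 5 q → c <ℚ ℕ→ℚ q * (ε * ε)))
theorem3p6 = + 1 ℚ./ 9216 , ℚ.1ℚ , ℚₚ.positive⁻¹ _ , ℚₚ.positive⁻¹ _ ,
  λ n ε ε>0 εn≤ large q (works , _) →
    let t , tε≤1 , 1<tε = floor-reciprocal ε ε>0 48
    in quadratic-bound ε>0 (48 ℕ.* ℕ.suc t) q 1<tε
         (square-bound t q (covers-nonempty ε>0 n q εn≤ works)
           (covers-quadratic ε>0 t n q tε≤1 large works))
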